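{- For all odd integers $d>1$ and $g_0\ge 3$ and every integer $\Delta>d$, \[ \chi'_d(R(\Delta,g_0))=\left\lceil\frac{\Delta g_0-1}{d g_0-1}\right\rceil , \] where $R(\Delta,g_0)$ is the almost full ring graph.
   Context: Multigraphs are finite and loopless; parallel edges are allowed. For a positive integer $d$, a $d$-defective edge coloring of a multigraph $G$ is an assignment of colors to the edges of $G$ such that, for each color, the subgraph formed by the edges of that color has maximum degree at most $d$ (degrees count edges with multiplicity). The $d$-defective chromatic index $\chi'_d(G)$ is the least $k$ such that $G$ has a $d$-defective edge coloring using at most $k$ colors. For a positive integer $\Delta$ and an odd integer $g_0\ge 3$, the almost full ring graph $R(\Delta,g_0)$ is the multigraph whose underlying graph is the cycle $v_1v_2\cdots v_{g_0}v_1$ and in which the number of parallel edges joining $v_i$ and $v_{i+1}$, for $1\le i\le g_0-1$, is $\lfloor\Delta/2\rfloor$ if $i$ is odd and $\lceil\Delta/2\rceil$ if $i$ is even, and the number of parallel edges joining $v_{g_0}$ and $v_1$ is $\lfloor\Delta/2\rfloor$. -}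

module Defs where

open import Data.Fin using (Fin; zero; suc; toℕ; fromℕ; inject₁; _≟_)
open import Data.Fin.Properties using (suc-injective)
open import Data.List using (List; map; filter; length; lookup; replicate; concatMap; allFin; _++_)
open import Data.List.Membership.Propositional.Properties using (∈-lookup)
open import Data.List.Relation.Unary.All as All using (All)
import Data.List.Relation.Unary.All.Properties as All
open import Data.Nat using (ℕ; zero; suc; _*_; _∸_; _≤_; _<_; s≤s; z≤n; ⌊_/2⌋; ⌈_/2⌉; parity; NonZero; >-nonZero)
open import Data.Nat.Properties using (*-mono-≤; ∸-monoˡ-≤; ≤-trans)
open import Data.Parity.Base using (0ℙ; 1ℙ)
open import Data.Product using (_×_; _,_; proj₁; proj₂)
open import Data.Sum using (_⊎_)
open import Relation.Binary.PropositionalEquality using (_≡_; _≢_)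
open import Relation.Nullary.Decidable using (Dec; _⊎-dec_)

Odd : ℕ → Set
Odd n = parity n ≡ 1ℙ

-- A multigraph on the vertices Fin n is a finite list of edges, each recorded
-- by its two ends in either order. An edge is a position in the list, so
-- repeated entries are distinct parallel edges.
record Multigraph (n : ℕ) : Set where
  field
    edges    : List (Fin n × Fin n)
    loopless : All (λ e → proj₁ e ≢ proj₂ e) edges

  Edge : Set
  Edge = Fin (length edges)

open Multigraph public

Incident : ∀ {n} → Fin n → Fin n × Fin n → Set
Incident v (u , w) = v ≡ u ⊎ v ≡ w

incident? : ∀ {n} (v : Fin n) (e : Fin n × Fin n) → Dec (Incident v e)
incident? v (u , w) = (v ≟ u) ⊎-dec (v ≟ w)

degree : ∀ {n} → Multigraph n → Fin n → ℕ
degree G v = length (filter (incident? v) (edges G))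

MaxDegree≤ : ∀ {n} → ℕ → Multigraph n → Set
MaxDegree≤ d G = ∀ v → degree G v ≤ d

-- The spanning subgraph formed by the edges of colour a.
colourClass : ∀ {n k} (G : Multigraph n) → (Edge G → Fin k) → Fin k → Multigraph n
colourClass G c a = record
  { edges    = map (lookup (edges G)) es
  ; loopless = All.map⁺ (All.universal (λ e → All.lookup (loopless G) (∈-lookup e)) es)
  }
  where
  es : List (Edge G)
  es = filter (λ e → c e ≟ a) (allFin (length (edges G)))

-- Not every colour of Fin k has to occur, so c uses at most k colours.
record DefectiveColouring {n} (d : ℕ) (G : Multigraph n) (k : ℕ) : Set where
  field
    colour    : Edge G → Fin k
    defective : ∀ a → MaxDegree≤ d (colourClass G colour a)

-- χ′_d(G) = k, i.e. k is the least number of colours that suffices.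
IsDefectiveChromaticIndex : ∀ {n} → ℕ → Multigraph n → ℕ → Set
IsDefectiveChromaticIndex d G k =
  DefectiveColouring d G k × (∀ j → DefectiveColouring d G j → k ≤ j)

-- Number of edges joining v_i and v_{i+1}, where i counts from 1.
multiplicity : ℕ → ℕ → ℕ
multiplicity Δ i with parity i
... | 1ℙ = ⌊ Δ /2⌋
... | 0ℙ = ⌈ Δ /2⌉

inject₁≢suc : ∀ {n} (i : Fin n) → inject₁ i ≢ suc i
inject₁≢suc zero    ()
inject₁≢suc (suc i) eq = inject₁≢suc i (suc-injective eq)

-- The almost full ring graph. The vertex v_i is the element i - 1 of Fin g₀,
-- so the index i : Fin (g₀ - 1) below stands for the pair v_{i+1}, v_{i+2}; the
-- last block joins v_{g₀} and v_1. Odd g₀ is the intended case.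
R : (Δ g₀ : ℕ) → 3 ≤ g₀ → Multigraph g₀
R Δ (suc zero)    (s≤s ())
R Δ (suc (suc m)) _ = record
  { edges    = concatMap path (allFin (suc m)) ++ replicate ⌊ Δ /2⌋ (fromℕ (suc m) , zero)
  ; loopless = All.++⁺
      (All.concat⁺ (All.map⁺ (All.universal
        (λ i → All.replicate⁺ (multiplicity Δ (suc (toℕ i))) (inject₁≢suc i)) (allFin (suc m)))))
      (All.replicate⁺ ⌊ Δ /2⌋ λ ())
  }
  where
  path : Fin (suc m) → List (Fin (suc (suc m)) × Fin (suc (suc m)))
  path i = replicate (multiplicity Δ (suc (toℕ i))) (inject₁ i , suc i)

d*g₀∸1-nonZero : ∀ {d g₀} → 1 < d → 3 ≤ g₀ → NonZero (d * g₀ ∸ 1)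
d*g₀∸1-nonZero 1<d 3≤g₀ =
  >-nonZero (≤-trans (s≤s z≤n) (∸-monoˡ-≤ 1 (*-mono-≤ 1<d 3≤g₀)))

module Submission where

-- Write d g₀ = 2M + 1 and let N be the number of edges of the ring graph, so that 2N is
-- Δ g₀ or Δ g₀ - 1. By the handshake lemma a colour class has at most M edges, whence k
-- colours require N ≤ k M, that is, Δ g₀ - 1 ≤ k (d g₀ - 1).
-- Conversely, if N ≤ k M, colour the edges round-robin modulo k along the cycle, inserting
-- gaps between consecutive bundles. The edges at a vertex then take each colour at most d
-- times as long as they fill, together with the gap between them, at most d k consecutive
-- places; this allows a gap of s = d k - Δ. The colouring closes up if the gaps add up to
-- T = M k - N, which turns the end of the list into a multiple of k, and T ≤ g₀ s. Bundle i
-- is therefore shifted by min (i s, T).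

open import Defs
open import Data.Bool using (true; false)
open import Data.Fin using (Fin; zero; suc; toℕ; fromℕ; inject₁; _≟_)
open import Data.Fin.Properties using (toℕ-fromℕ; toℕ-fromℕ<; toℕ-inject₁; toℕ-injective; toℕ<n; injective⇒≤)
import Data.Integer as ℤ
import Data.Integer.DivMod as ℤ
import Data.Integer.Properties as ℤ
open import Data.Integer using (-[1+_])
open import Data.List using (List; []; _∷_; map; filter; length; lookup; replicate; concat; tabulate; allFin; _++_)
open import Data.List.Membership.Propositional using (_∈_)
open import Data.List.Membership.Propositional.Properties using (∈-lookup)
open import Data.List.Properties using (length-map; length-++; length-tabulate; length-replicate; map-tabulate; filter-++; filter-accept)
open import Data.List.Relation.Unary.All as All using (All; []; _∷_)
import Data.List.Relation.Unary.All.Properties as All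
open import Data.List.Relation.Unary.AllPairs using ([]; _∷_)
open import Data.List.Relation.Unary.Unique.Propositional using (Unique)
import Data.List.Relation.Unary.Unique.Propositional.Properties as Unique
import Data.Nat as ℕ
open import Data.Nat using (ℕ; zero; suc; _+_; _*_; _∸_; _⊓_; _≤_; _<_; _%_; s≤s; z≤n; ⌊_/2⌋; ⌈_/2⌉; NonZero; >-nonZero; >-nonZero⁻¹)
open import Data.Nat.DivMod using (_mod_; m≡m%n+[m/n]*n; m%n<n; [m+kn]%n≡m%n)
open import Data.Nat.Properties hiding (_≟_)
open import Data.Nat.Tactic.RingSolver using (solve-∀)
open import Data.Product using (∃-syntax; _×_; _,_; proj₁; proj₂)
open import Data.Rational.Unnormalised using (_/_; ceiling)
open import Data.Sum using (_⊎_; inj₁; inj₂)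
open import Algebra.Properties.CommutativeMonoid.Sum +-0-commutativeMonoid using (sum; ∑-distrib-+; sum-cong-≗)
open import Function using (_∘_)
open import Relation.Binary using (tri<; tri≈; tri>)
open import Relation.Binary.PropositionalEquality using (_≡_; _≢_; refl; sym; trans; cong; subst; module ≡-Reasoning)
open import Relation.Nullary using (Dec; contradiction)
open import Relation.Nullary.Decidable using (does)

private
  variable
    A B : Set

-- Double counting and the lower bound

term≤sum : ∀ {n} (f : Fin n → ℕ) i → f i ≤ sum f
term≤sum f zero    = m≤m+n _ _
term≤sum f (suc i) = ≤-trans (term≤sum (f ∘ suc) i) (m≤n+m _ _)

two-terms≤sum : ∀ {n} (f : Fin n → ℕ) {i j} → i ≢ j → f i + f j ≤ sum f
two-terms≤sum f {zero}  {zero}  i≢j = contradiction refl i≢j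
two-terms≤sum f {zero}  {suc j} i≢j = +-monoʳ-≤ (f zero) (term≤sum (f ∘ suc) j)
two-terms≤sum f {suc i} {zero}  i≢j =
  ≤-trans (≤-reflexive (+-comm (f (suc i)) (f zero))) (+-monoʳ-≤ (f zero) (term≤sum (f ∘ suc) i))
two-terms≤sum f {suc i} {suc j} i≢j =
  ≤-trans (two-terms≤sum (f ∘ suc) (i≢j ∘ cong suc)) (m≤n+m _ _)

sum≤*-bound : ∀ {n b} (f : Fin n → ℕ) → (∀ i → f i ≤ b) → sum f ≤ n * b
sum≤*-bound {zero}  f f≤b = z≤n
sum≤*-bound {suc n} f f≤b = +-mono-≤ (f≤b zero) (sum≤*-bound (f ∘ suc) (f≤b ∘ suc))

length-filter-map : ∀ {P : B → Set} (P? : ∀ y → Dec (P y)) (f : A → B) xs →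
                    length (filter P? (map f xs)) ≡ length (filter (P? ∘ f) xs)
length-filter-map P? f [] = refl
length-filter-map P? f (x ∷ xs) with does (P? (f x))
... | true  = cong suc (length-filter-map P? f xs)
... | false = length-filter-map P? f xs

module _ {n : ℕ} {P : Fin n → A → Set} (P? : ∀ v x → Dec (P v x)) where

  1≤filter : ∀ {v x} → P v x → 1 ≤ length (filter (P? v) (x ∷ []))
  1≤filter {v} {x} p rewrite filter-accept (P? v) {x} {[]} p = ≤-refl

  -- Each `x` contributes at least `r` to the sum over `v`. It serves twice: with incidence and
  -- `r = 2` for the handshake, and with colours and `r = 1` to split the edges into colour classes.
  double-count : ∀ r xs → All (λ x → r ≤ sum (λ v → length (filter (P? v) (x ∷ [])))) xs →
                 length xs * r ≤ sum (λ v → length (filter (P? v) xs))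
  double-count r [] [] = z≤n
  double-count r (x ∷ xs) (r≤ ∷ rs) = begin
    r + length xs * r
      ≤⟨ +-mono-≤ r≤ (double-count r xs rs) ⟩
    sum (λ v → length (filter (P? v) (x ∷ []))) + sum (λ v → length (filter (P? v) xs))
      ≡⟨ ∑-distrib-+ (λ v → length (filter (P? v) (x ∷ []))) (λ v → length (filter (P? v) xs)) ⟨
    sum (λ v → length (filter (P? v) (x ∷ [])) + length (filter (P? v) xs))
      ≡⟨ sum-cong-≗ (λ v → trans (cong length (filter-++ (P? v) (x ∷ []) xs))
                                 (length-++ (filter (P? v) (x ∷ [])))) ⟨
    sum (λ v → length (filter (P? v) (x ∷ xs))) ∎
    where open ≤-Reasoning

handshake : ∀ {n} (G : Multigraph n) → length (edges G) * 2 ≤ sum (degree G)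
handshake G = double-count incident? 2 (edges G) (All.map two-ends (loopless G))
  where
  two-ends : ∀ {e} → proj₁ e ≢ proj₂ e → 2 ≤ sum (λ v → length (filter (incident? v) (e ∷ [])))
  two-ends {u , w} u≢w = ≤-trans
    (+-mono-≤ (1≤filter incident? {u} {u , w} (inj₁ refl)) (1≤filter incident? {w} {u , w} (inj₂ refl)))
    (two-terms≤sum (λ v → length (filter (incident? v) ((u , w) ∷ []))) u≢w)

2m≤1+2n⇒m≤n : ∀ m n → m * 2 ≤ suc (n * 2) → m ≤ n
2m≤1+2n⇒m≤n m n le = ≤-pred (*-cancelʳ-< 2 m (suc n) (s≤s le))

module _ {n d k M : ℕ} {G : Multigraph n} (n*d≡1+2M : n * d ≡ suc (M * 2)) (C : DefectiveColouring d G k) where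
  open DefectiveColouring C
  open ≤-Reasoning

  -- Twice the size is at most `n * d`, which is odd, so halving rounds down to `M`.
  colourClass-size≤ : ∀ a → length (edges (colourClass G colour a)) ≤ M
  colourClass-size≤ a = 2m≤1+2n⇒m≤n _ M (begin
    length (edges (colourClass G colour a)) * 2  ≤⟨ handshake (colourClass G colour a) ⟩
    sum (degree (colourClass G colour a))        ≤⟨ sum≤*-bound _ (defective a) ⟩
    n * d                                        ≡⟨ n*d≡1+2M ⟩
    suc (M * 2)                                  ∎)

  size≤colours*M : length (edges G) ≤ k * M
  size≤colours*M = begin
    length (edges G)                       ≡⟨ length-tabulate {n = length (edges G)} (λ e → e) ⟨
    length (allFin (length (edges G)))     ≡⟨ *-identityʳ _ ⟨
    length (allFin (length (edges G))) * 1
      ≤⟨ double-count (λ a e → colour e ≟ a) 1 (allFin _) (All.universal coloured (allFin _)) ⟩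
    sum (λ a → length (filter (λ e → colour e ≟ a) (allFin (length (edges G)))))
      ≤⟨ sum≤*-bound _ (λ a → ≤-trans
           (≤-reflexive (sym (length-map (lookup (edges G)) (filter (λ e → colour e ≟ a) (allFin _)))))
           (colourClass-size≤ a)) ⟩
    k * M ∎
    where
    coloured : ∀ e → 1 ≤ sum (λ a → length (filter (λ e → colour e ≟ a) (e ∷ [])))
    coloured e = ≤-trans (1≤filter (λ a e → colour e ≟ a) refl)
      (term≤sum (λ a → length (filter (λ e → colour e ≟ a) (e ∷ []))) (colour e))

-- Residue classes in a window

lookup-injective : ∀ {xs : List A} → Unique xs → ∀ {i j} → lookup xs i ≡ lookup xs j → i ≡ j
lookup-injective (x∉ ∷ _)  {zero}  {zero}  eq = refl
lookup-injective (x∉ ∷ _)  {zero}  {suc j} eq = contradiction eq (All.lookup x∉ (∈-lookup j))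
lookup-injective (x∉ ∷ _)  {suc i} {zero}  eq = contradiction (sym eq) (All.lookup x∉ (∈-lookup i))
lookup-injective (_ ∷ xs!) {suc i} {suc j} eq = cong suc (lookup-injective xs! eq)

module _ {m o n : ℕ} .{{_ : NonZero n}} (m≡o : m % n ≡ o % n) (m<o : m < o) where
  open ≤-Reasoning

  congruent⇒/-< : m ℕ./ n < o ℕ./ n
  congruent⇒/-< = ≰⇒> λ o/n≤m/n → <⇒≱ m<o (begin
    o                    ≡⟨ m≡m%n+[m/n]*n o n ⟩
    o % n + o ℕ./ n * n  ≤⟨ +-mono-≤ (≤-reflexive (sym m≡o)) (*-monoˡ-≤ n o/n≤m/n) ⟩
    m % n + m ℕ./ n * n  ≡⟨ m≡m%n+[m/n]*n m n ⟨
    m                    ∎)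

  congruent⇒quotient-gap : ∀ {q} → m ℕ./ n + q ≤ o ℕ./ n → m + q * n ≤ o
  congruent⇒quotient-gap {q} le = begin
    m + q * n                      ≡⟨ cong (_+ q * n) (m≡m%n+[m/n]*n m n) ⟩
    m % n + m ℕ./ n * n + q * n    ≡⟨ +-assoc (m % n) _ _ ⟩
    m % n + (m ℕ./ n * n + q * n)  ≡⟨ cong (λ z → m % n + z) (*-distribʳ-+ n (m ℕ./ n) q) ⟨
    m % n + (m ℕ./ n + q) * n      ≤⟨ +-mono-≤ (≤-reflexive m≡o) (*-monoˡ-≤ n le) ⟩
    o % n + o ℕ./ n * n            ≡⟨ m≡m%n+[m/n]*n o n ⟨
    o                              ∎

congruent⇒gap : ∀ {m o n} .{{_ : NonZero n}} → m % n ≡ o % n → m < o → m + n ≤ o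
congruent⇒gap {m} {o} {n} m≡o m<o = subst (λ z → m + z ≤ o) (*-identityˡ n)
  (congruent⇒quotient-gap m≡o m<o (subst (_≤ o ℕ./ n) (+-comm 1 (m ℕ./ n)) (congruent⇒/-< m≡o m<o)))

toℕ-mod : ∀ m n .{{_ : NonZero n}} → toℕ (m mod n) ≡ m % n
toℕ-mod m n = toℕ-fromℕ< (m%n<n m n)

-- The quotients by k lie in a window of length d, so they are distinct modulo d.
congruent-in-window⇒length≤ : ∀ {k d a W xs} .{{_ : NonZero k}} .{{_ : NonZero d}} →
  Unique xs → All (λ x → x % k ≡ a) xs → All (λ x → W ≤ x × x < W + d * k) xs → length xs ≤ d
congruent-in-window⇒length≤ {k} {d} {a} {W} {xs} xs! ≡a window =
  injective⇒≤ {f = λ i → (lookup xs i ℕ./ k) mod d} λ {i} {j} eq →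
    lookup-injective xs! (quotients-distinct (∈-lookup i) (∈-lookup j)
      (trans (sym (toℕ-mod _ d)) (trans (cong toℕ eq) (toℕ-mod _ d))))
  where
  no-gap : ∀ {x y} → x ∈ xs → y ∈ xs → (x ℕ./ k) % d ≡ (y ℕ./ k) % d → x < y → x ≡ y
  -- The quotients differ and agree modulo `d`, so they are at least `d` apart. Then
  -- `x + d * k ≤ y`, which puts `y` outside the window.
  no-gap x∈ y∈ eq x<y = contradiction
    (congruent⇒quotient-gap x≡y x<y (congruent⇒gap eq (congruent⇒/-< x≡y x<y)))
    (<⇒≱ (<-≤-trans (proj₂ (All.lookup window y∈)) (+-monoˡ-≤ (d * k) (proj₁ (All.lookup window x∈)))))
    where x≡y = trans (All.lookup ≡a x∈) (sym (All.lookup ≡a y∈))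

  quotients-distinct : ∀ {x y} → x ∈ xs → y ∈ xs → (x ℕ./ k) % d ≡ (y ℕ./ k) % d → x ≡ y
  quotients-distinct {x} {y} x∈ y∈ eq with <-cmp x y
  ... | tri< x<y _ _ = no-gap x∈ y∈ eq x<y
  ... | tri≈ _ x≡y _ = x≡y
  ... | tri> _ _ y<x = sym (no-gap y∈ x∈ (sym eq) y<x)

-- `ceiling` is minus the floor of the negated fraction, and dividing a negative integer branches on
-- whether the remainder vanishes. A zero remainder gives the exact quotient `q`; otherwise
-- `q * m < n`, so every admissible `j` exceeds `q`.
ceiling-least : ∀ n m .{{_ : NonZero m}} → 0 < n →
  ∃[ k ] (ℤ.+ k ≡ ⌈ ℤ.+ n / m ⌉ × n ≤ k * m × (∀ j → n ≤ j * m → k ≤ j))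
ceiling-least (suc n) (suc m) _
  rewrite ℤ.div-pos-is-/ℕ -[1+ n ] (suc m) {{_}}
  with suc n % suc m | m≡m%n+[m/n]*n (suc n) (suc m) | m%n<n (suc n) (suc m)
... | zero  | n≡ | _   = suc n ℕ./ suc m , sym (ℤ.neg-involutive _) , ≤-reflexive n≡ ,
  λ j n≤ → *-cancelʳ-≤ _ j (suc m) (≤-trans (≤-reflexive (sym n≡)) n≤)
... | suc r | n≡ | r<m = suc (suc n ℕ./ suc m) , refl ,
  ≤-trans (≤-reflexive n≡) (+-monoˡ-≤ _ (<⇒≤ r<m)) ,
  λ j n≤ → *-cancelʳ-< (suc m) _ j
    (≤-trans (s≤s (m≤n+m _ r)) (≤-trans (≤-reflexive (sym n≡)) n≤))

-- The edge list of the ring graph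

-- The colouring depends on where an edge stands in the list and not only on its ends, hence a
-- relation between position and entry.
Indexed : (ℕ → A → Set) → List A → Set
Indexed Q xs = ∀ i → Q (toℕ i) (lookup xs i)

Indexed-++ : ∀ (Q : ℕ → A → Set) xs {ys} →
             Indexed Q xs → Indexed (λ x → Q (length xs + x)) ys → Indexed Q (xs ++ ys)
Indexed-++ Q []       p q         = q
Indexed-++ Q (_ ∷ xs) p q zero    = p zero
Indexed-++ Q (_ ∷ xs) p q (suc i) = Indexed-++ (Q ∘ suc) xs (p ∘ suc) q i

Indexed-replicate : ∀ (Q : ℕ → A → Set) {n a} → (∀ x → x < n → Q x a) → Indexed Q (replicate n a)
Indexed-replicate Q {suc n} q zero    = q 0 (s≤s z≤n)
Indexed-replicate Q {suc n} q (suc i) =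
  Indexed-replicate (Q ∘ suc) (λ x x<n → q (suc x) (s≤s x<n)) i

-- p lists the positions at which the blocks F i begin.
Indexed-concat : ∀ {n} (Q : ℕ → A → Set) (p : ℕ → ℕ) (F : Fin n → List A) →
                 (∀ i → p (suc (toℕ i)) ≡ p (toℕ i) + length (F i)) →
                 (∀ i → Indexed (λ x → Q (p (toℕ i) + x)) (F i)) →
                 Indexed (λ x → Q (p 0 + x)) (concat (tabulate F))
Indexed-concat {n = suc n} Q p F step q = Indexed-++ (λ x → Q (p 0 + x)) (F zero) (q zero) λ i →
  subst (λ z → Q z (lookup (concat (tabulate (F ∘ suc))) i))
    (trans (cong (_+ toℕ i) (step zero)) (+-assoc (p 0) _ _))
    (Indexed-concat Q (p ∘ suc) (F ∘ suc) (step ∘ suc) (q ∘ suc) i)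

length-concat : ∀ {n} (p : ℕ → ℕ) (F : Fin n → List A) →
                (∀ i → p (suc (toℕ i)) ≡ p (toℕ i) + length (F i)) →
                p 0 + length (concat (tabulate F)) ≡ p n
length-concat {n = zero}  p F step = +-identityʳ (p 0)
length-concat {n = suc n} p F step = begin
  p 0 + length (F zero ++ concat (tabulate (F ∘ suc)))            ≡⟨ cong (p 0 +_) (length-++ (F zero)) ⟩
  p 0 + (length (F zero) + length (concat (tabulate (F ∘ suc))))  ≡⟨ +-assoc (p 0) _ _ ⟨
  p 0 + length (F zero) + length (concat (tabulate (F ∘ suc)))    ≡⟨ cong (_+ _) (step zero) ⟨
  p 1 + length (concat (tabulate (F ∘ suc)))                      ≡⟨ length-concat (p ∘ suc) (F ∘ suc) (step ∘ suc) ⟩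
  p (suc n)                                                       ∎
  where open ≡-Reasoning

-- Bundle sizes and offsets

multiplicity-odd : ∀ Δ i → Odd i → multiplicity Δ i ≡ ⌊ Δ /2⌋
multiplicity-odd Δ i odd rewrite odd = refl

multiplicity-suc-odd : ∀ Δ i → Odd i → multiplicity Δ (suc i) ≡ ⌈ Δ /2⌉
multiplicity-suc-odd Δ (suc zero)    odd = refl
multiplicity-suc-odd Δ (suc (suc i)) odd = multiplicity-suc-odd Δ i odd

multiplicity-pair : ∀ Δ i → multiplicity Δ i + multiplicity Δ (suc i) ≡ Δ
multiplicity-pair Δ zero          = trans (+-comm ⌈ Δ /2⌉ _) (⌊n/2⌋+⌈n/2⌉≡n Δ)
multiplicity-pair Δ (suc zero)    = ⌊n/2⌋+⌈n/2⌉≡n Δ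
multiplicity-pair Δ (suc (suc i)) = multiplicity-pair Δ i

-- The position in the edge list of the first edge of the i-th bundle, where i counts from 0.
offset : ℕ → ℕ → ℕ
offset Δ zero    = 0
offset Δ (suc i) = offset Δ i + multiplicity Δ (suc i)

offset-mono : ∀ Δ {i j} → i ≤ j → offset Δ i ≤ offset Δ j
offset-mono Δ {i} {zero}  z≤n = ≤-refl
offset-mono Δ {i} {suc j} i≤1+j with m≤n⇒m<n∨m≡n i≤1+j
... | inj₁ (s≤s i≤j) = ≤-trans (offset-mono Δ i≤j) (m≤m+n _ _)
... | inj₂ refl      = ≤-refl

offset-+2 : ∀ Δ i → offset Δ (suc (suc i)) ≡ offset Δ i + Δ
offset-+2 Δ i = trans (+-assoc (offset Δ i) _ _) (cong (offset Δ i +_) (multiplicity-pair Δ (suc i)))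

-- Adding neighbouring offsets turns floors and ceilings into whole copies of `Δ`. For odd `g` this
-- determines `offset Δ g * 2` up to the difference of `⌈ Δ /2⌉` and `⌊ Δ /2⌋`.
offset-pair : ∀ Δ i → offset Δ i + offset Δ (suc i) ≡ i * Δ + ⌊ Δ /2⌋
offset-pair Δ zero    = refl
offset-pair Δ (suc i) = begin
  offset Δ (suc i) + offset Δ (suc (suc i))  ≡⟨ cong (offset Δ (suc i) +_) (offset-+2 Δ i) ⟩
  offset Δ (suc i) + (offset Δ i + Δ)        ≡⟨ rearrange (offset Δ (suc i)) (offset Δ i) Δ ⟩
  Δ + (offset Δ i + offset Δ (suc i))        ≡⟨ cong (Δ +_) (offset-pair Δ i) ⟩
  Δ + (i * Δ + ⌊ Δ /2⌋)                      ≡⟨ +-assoc Δ _ _ ⟨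
  suc i * Δ + ⌊ Δ /2⌋                        ∎
  where
  open ≡-Reasoning
  rearrange : ∀ a b c → a + (b + c) ≡ c + (b + a)
  rearrange = solve-∀

module _ (Δ g : ℕ) (odd : Odd g) where
  open ≤-Reasoning

  private
    split : offset Δ g * 2 + ⌈ Δ /2⌉ ≡ g * Δ + ⌊ Δ /2⌋
    split = trans (rearrange (offset Δ g) ⌈ Δ /2⌉)
      (subst (λ z → offset Δ g + (offset Δ g + z) ≡ g * Δ + ⌊ Δ /2⌋) (multiplicity-suc-odd Δ g odd) (offset-pair Δ g))
      where
      rearrange : ∀ a b → a * 2 + b ≡ a + (a + b)
      rearrange = solve-∀

  2*offset≤ : offset Δ g * 2 ≤ g * Δ
  2*offset≤ = +-cancelʳ-≤ ⌊ Δ /2⌋ _ _ (begin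
    offset Δ g * 2 + ⌊ Δ /2⌋  ≤⟨ +-monoʳ-≤ (offset Δ g * 2) (⌊n/2⌋≤⌈n/2⌉ Δ) ⟩
    offset Δ g * 2 + ⌈ Δ /2⌉  ≡⟨ split ⟩
    g * Δ + ⌊ Δ /2⌋           ∎)

  ≤1+2*offset : g * Δ ≤ suc (offset Δ g * 2)
  ≤1+2*offset = +-cancelʳ-≤ ⌊ Δ /2⌋ _ _ (begin
    g * Δ + ⌊ Δ /2⌋                ≡⟨ split ⟨
    -- `⌈ Δ /2⌉` unfolds to `⌊ suc Δ /2⌋`, and `suc ⌊ Δ /2⌋` is `⌊ suc (suc Δ) /2⌋`.
    offset Δ g * 2 + ⌈ Δ /2⌉       ≤⟨ +-monoʳ-≤ (offset Δ g * 2) (⌊n/2⌋-mono (n≤1+n (suc Δ))) ⟩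
    offset Δ g * 2 + suc ⌊ Δ /2⌋   ≡⟨ +-suc _ _ ⟩
    suc (offset Δ g * 2) + ⌊ Δ /2⌋ ∎)

Within : ℕ → ℕ → ℕ → Set
Within Δ x i = offset Δ i ≤ x × x < offset Δ (suc i)

-- The first end of an edge names its bundle. The second alternative is the closing bundle, which
-- returns to the vertex `0`.
Located : ∀ {n} → ℕ → ℕ → Fin n × Fin n → Set
Located {n} Δ x (u , w) =
  Within Δ x (toℕ u) × (toℕ w ≡ suc (toℕ u) ⊎ (toℕ w ≡ 0 × suc (toℕ u) ≡ n))

module _ (Δ : ℕ) {m : ℕ} (odd : Odd (suc (suc m))) (3≤g : 3 ≤ suc (suc m)) where

  private
    path : Fin (suc m) → List (Fin (suc (suc m)) × Fin (suc (suc m)))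
    path i = replicate (multiplicity Δ (suc (toℕ i))) (inject₁ i , suc i)

    closing : List (Fin (suc (suc m)) × Fin (suc (suc m)))
    closing = replicate ⌊ Δ /2⌋ (fromℕ (suc m) , zero)

    edges≡ : edges (R Δ (suc (suc m)) 3≤g) ≡ concat (tabulate path) ++ closing
    edges≡ = cong (λ es → concat es ++ closing) (map-tabulate (λ i → i) path)

    step : ∀ i → offset Δ (suc (toℕ i)) ≡ offset Δ (toℕ i) + length (path i)
    step i = cong (offset Δ (toℕ i) +_) (sym (length-replicate (multiplicity Δ (suc (toℕ i)))))

    within : ∀ i x → x < multiplicity Δ (suc i) → Within Δ (offset Δ i + x) i
    within i x x< = m≤m+n _ x , +-monoʳ-< (offset Δ i) x<

    path-located : ∀ i → Indexed (λ x → Located Δ (offset Δ (toℕ i) + x)) (path i)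
    path-located i = Indexed-replicate (λ x → Located Δ (offset Δ (toℕ i) + x)) λ x x< →
      subst (λ j → Within Δ (offset Δ (toℕ i) + x) j × (suc (toℕ i) ≡ suc j ⊎ (suc (toℕ i) ≡ 0 × suc j ≡ suc (suc m))))
        (sym (toℕ-inject₁ i)) (within (toℕ i) x x< , inj₁ refl)

    length-paths : length (concat (tabulate path)) ≡ offset Δ (suc m)
    length-paths = length-concat (offset Δ) path step

    closing-located : Indexed (λ x → Located Δ (length (concat (tabulate path)) + x)) closing
    closing-located = Indexed-replicate (λ x → Located Δ (length (concat (tabulate path)) + x)) λ x x< →
      subst (λ j → Within Δ (length (concat (tabulate path)) + x) j × (0 ≡ suc j ⊎ (0 ≡ 0 × suc j ≡ suc (suc m))))
        (sym (toℕ-fromℕ (suc m)))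
        ( subst (λ z → Within Δ (z + x) (suc m)) (sym length-paths)
            (within (suc m) x (subst (x <_) (sym (multiplicity-odd Δ (suc (suc m)) odd)) x<))
        , inj₂ (refl , refl))

  -- The closing block also fits the numbering: as the number of vertices is odd, its size `⌊ Δ /2⌋`
  -- is the multiplicity at that index.
  edges-located : Indexed (Located Δ) (edges (R Δ (suc (suc m)) 3≤g))
  edges-located = subst (Indexed (Located Δ)) (sym edges≡)
    (Indexed-++ (Located Δ) (concat (tabulate path))
      (Indexed-concat (Located Δ) (offset Δ) path step path-located) closing-located)

  size≡offset : length (edges (R Δ (suc (suc m)) 3≤g)) ≡ offset Δ (suc (suc m))
  size≡offset = begin
    length (edges (R Δ (suc (suc m)) 3≤g))             ≡⟨ cong length edges≡ ⟩
    length (concat (tabulate path) ++ closing)         ≡⟨ length-++ (concat (tabulate path)) ⟩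
    length (concat (tabulate path)) + length closing
      ≡⟨ trans (cong (_+ length closing) length-paths) (cong (offset Δ (suc m) +_) (length-replicate ⌊ Δ /2⌋)) ⟩
    offset Δ (suc m) + ⌊ Δ /2⌋                         ≡⟨ cong (offset Δ (suc m) +_) (multiplicity-odd Δ (suc (suc m)) odd) ⟨
    offset Δ (suc (suc m))                             ∎
    where open ≡-Reasoning

-- The round-robin colouring

degree-colourClass : ∀ {n k} (G : Multigraph n) (c : Edge G → Fin k) a v →
  degree (colourClass G c a) v ≡
  length (filter (incident? v ∘ lookup (edges G)) (filter (λ e → c e ≟ a) (allFin _)))
degree-colourClass G c a v =
  length-filter-map (incident? v) (lookup (edges G)) (filter (λ e → c e ≟ a) (allFin _))

module RoundRobin {d Δ m k M s T : ℕ}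
  .{{_ : NonZero d}} .{{_ : NonZero k}}
  (odd : Odd (suc (suc m))) (3≤g : 3 ≤ suc (suc m))
  (Δ+s≡d*k : Δ + s ≡ d * k)
  (offset+T≡M*k : offset Δ (suc (suc m)) + T ≡ M * k)
  (T≤g*s : T ≤ suc (suc m) * s)
  where

  private
    g : ℕ
    g = suc (suc m)

    G : Multigraph g
    G = R Δ g 3≤g

  shift : ℕ → ℕ
  shift i = i * s ⊓ T

  shift-mono : ∀ {i j} → i ≤ j → shift i ≤ shift j
  shift-mono i≤j = ⊓-monoˡ-≤ T (*-monoˡ-≤ s i≤j)

  shift-suc : ∀ i → shift (suc i) ≤ shift i + s
  shift-suc i = begin
    (s + i * s) ⊓ T        ≤⟨ ⊓-monoʳ-≤ (s + i * s) (m≤n+m T s) ⟩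
    (s + i * s) ⊓ (s + T)  ≡⟨ +-distribˡ-⊓ s (i * s) T ⟨
    s + shift i            ≡⟨ +-comm s (shift i) ⟩
    shift i + s            ∎
    where open ≤-Reasoning

  shift-g : shift g ≡ T
  shift-g = m≥n⇒m⊓n≡n T≤g*s

  -- Bundles `i` and `suc i` hold `Δ` edges together, and the gap between them is at most `s`, so
  -- they span at most `Δ + s` places.
  bundles-fit : ∀ i → offset Δ (suc (suc i)) + shift (suc i) ≤ offset Δ i + shift i + d * k
  bundles-fit i = begin
    offset Δ (suc (suc i)) + shift (suc i)  ≤⟨ +-mono-≤ (≤-reflexive (offset-+2 Δ i)) (shift-suc i) ⟩
    offset Δ i + Δ + (shift i + s)          ≡⟨ rearrange (offset Δ i) Δ (shift i) s ⟩
    offset Δ i + shift i + (Δ + s)          ≡⟨ cong (λ z → offset Δ i + shift i + z) Δ+s≡d*k ⟩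
    offset Δ i + shift i + d * k            ∎
    where
    open ≤-Reasoning
    rearrange : ∀ a b c e → a + b + (c + e) ≡ a + c + (b + e)
    rearrange = solve-∀

  in-window : ∀ {x i b} → Within Δ x i → i ≡ b ⊎ i ≡ suc b →
              offset Δ b + shift b ≤ x + shift i × x + shift i < offset Δ b + shift b + d * k
  in-window {b = b} (≤x , x<) (inj₁ refl) = +-monoˡ-≤ (shift b) ≤x ,
    <-≤-trans (+-mono-<-≤ x< (shift-mono (n≤1+n b)))
      (≤-trans (+-monoˡ-≤ _ (offset-mono Δ (n≤1+n (suc b)))) (bundles-fit b))
  in-window {b = b} (≤x , x<) (inj₂ refl) =
    +-mono-≤ (≤-trans (offset-mono Δ (n≤1+n b)) ≤x) (shift-mono (n≤1+n b)) ,
    <-≤-trans (+-monoˡ-< (shift (suc b)) x<) (bundles-fit b)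

  -- A later edge lies in the same or a later bundle, and shifts never decrease.
  shifted-< : ∀ {x y} i j → Within Δ x i → Within Δ y j → x < y → x + shift i < y + shift j
  shifted-< {x} {y} i j (≤x , _) (_ , y<) x<y = +-mono-<-≤ x<y (shift-mono {i} {j} (≮⇒≥ λ j<i →
    <⇒≱ x<y (≤-trans (<⇒≤ y<) (≤-trans (offset-mono Δ j<i) ≤x))))

  shifted-injective : ∀ {x y} i j → Within Δ x i → Within Δ y j → x + shift i ≡ y + shift j → x ≡ y
  shifted-injective {x} {y} i j wx wy eq with <-cmp x y
  ... | tri< x<y _ _ = contradiction eq (<⇒≢ (shifted-< i j wx wy x<y))
  ... | tri≈ _ x≡y _ = x≡y
  ... | tri> _ _ y<x = contradiction (sym eq) (<⇒≢ (shifted-< j i wy wx y<x))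

  -- Around v₁ the first bundle is renumbered as bundle g, so that it follows the last one.
  unrolledIndex : Fin g → Fin g → ℕ
  unrolledIndex zero    zero    = g
  unrolledIndex zero    (suc u) = suc (toℕ u)
  unrolledIndex (suc _) u       = toℕ u

  unrolledOrdinal : Fin g → Fin g → ℕ → ℕ
  unrolledOrdinal zero    zero    x = x + offset Δ g
  unrolledOrdinal zero    (suc _) x = x
  unrolledOrdinal (suc _) _       x = x

  unrolled : Fin g → Fin g → ℕ → ℕ
  unrolled v u x = unrolledOrdinal v u x + shift (unrolledIndex v u)

  unrolled-within : ∀ v u {x} → Within Δ x (toℕ u) → Within Δ (unrolledOrdinal v u x) (unrolledIndex v u)
  unrolled-within zero    zero    {x} (_ , x<) = m≤n+m _ x , (begin-strict
    x + offset Δ g                       <⟨ +-monoˡ-< (offset Δ g) x< ⟩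
    -- The first bundle has `⌊ Δ /2⌋` edges, while the index `g` leaves room for `⌈ Δ /2⌉`, since
    -- `suc g` is even; the bundle may fall short of filling it.
    ⌊ Δ /2⌋ + offset Δ g                 ≤⟨ +-monoˡ-≤ (offset Δ g) (⌊n/2⌋≤⌈n/2⌉ Δ) ⟩
    ⌈ Δ /2⌉ + offset Δ g                 ≡⟨ +-comm ⌈ Δ /2⌉ _ ⟩
    offset Δ g + ⌈ Δ /2⌉                 ≡⟨ cong (offset Δ g +_) (multiplicity-suc-odd Δ g odd) ⟨
    offset Δ g + multiplicity Δ (suc g)  ∎)
    where open ≤-Reasoning
  unrolled-within zero    (suc _) w = w
  unrolled-within (suc _) _       w = w

  -- Renumbering adds offset Δ g + T = M * k to the shifted positions of the first bundle.
  unrolled-% : ∀ v u x → unrolled v u x % k ≡ (x + shift (toℕ u)) % k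
  unrolled-% zero    zero    x = begin
    (x + offset Δ g + shift g) % k    ≡⟨ cong (_% k) (+-assoc x _ _) ⟩
    (x + (offset Δ g + shift g)) % k  ≡⟨ cong (λ z → (x + (offset Δ g + z)) % k) shift-g ⟩
    (x + (offset Δ g + T)) % k        ≡⟨ cong (λ z → (x + z) % k) offset+T≡M*k ⟩
    (x + M * k) % k                   ≡⟨ [m+kn]%n≡m%n x M k ⟩
    x % k                             ≡⟨ cong (_% k) (+-identityʳ x) ⟨
    (x + 0) % k                       ∎
    where open ≡-Reasoning
  unrolled-% zero    (suc _) x = refl
  unrolled-% (suc _) _       x = refl

  -- Only the first bundle around v₁ is moved, and it lands at or beyond `offset Δ g`, past all
  -- other edges.
  unrolledOrdinal-injective : ∀ v u u′ {x y} → Within Δ x (toℕ u) → Within Δ y (toℕ u′) →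
    unrolledOrdinal v u x ≡ unrolledOrdinal v u′ y → x ≡ y
  unrolledOrdinal-injective zero zero zero _ _ eq = +-cancelʳ-≡ _ _ _ eq
  unrolledOrdinal-injective zero zero (suc u′) {x} _ (_ , y<) eq = contradiction (sym eq)
    (<⇒≢ (<-≤-trans y< (≤-trans (offset-mono Δ (toℕ<n (suc u′))) (m≤n+m _ x))))
  unrolledOrdinal-injective zero (suc u) zero {y = y} (_ , x<) _ eq = contradiction eq
    (<⇒≢ (<-≤-trans x< (≤-trans (offset-mono Δ (toℕ<n (suc u))) (m≤n+m _ y))))
  unrolledOrdinal-injective zero    (suc _) (suc _) _ _ eq = eq
  unrolledOrdinal-injective (suc _) _       _       _ _ eq = eq

  unrolled-injective : ∀ v u u′ {x y} → Within Δ x (toℕ u) → Within Δ y (toℕ u′) →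
    unrolled v u x ≡ unrolled v u′ y → x ≡ y
  unrolled-injective v u u′ wx wy eq = unrolledOrdinal-injective v u u′ wx wy
    (shifted-injective (unrolledIndex v u) (unrolledIndex v u′)
      (unrolled-within v u wx) (unrolled-within v u′ wy) eq)

  -- The bundle arriving at a vertex. For v₁ this is the closing bundle `suc m`, whose successor `g`
  -- is the renumbered first bundle.
  previous : Fin g → ℕ
  previous zero    = suc m
  previous (suc v) = toℕ v

  incident-bundles : ∀ v u w → toℕ w ≡ suc (toℕ u) ⊎ (toℕ w ≡ 0 × suc (toℕ u) ≡ g) → Incident v (u , w) →
    unrolledIndex v u ≡ previous v ⊎ unrolledIndex v u ≡ suc (previous v)
  incident-bundles zero    u       w _                (inj₁ refl) = inj₂ refl
  incident-bundles zero    zero    w (inj₂ (_ , 1≡g)) (inj₂ refl) = contradiction 1≡g λ ()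
  incident-bundles zero    (suc u) w (inj₂ (_ , u≡))  (inj₂ refl) = inj₁ (suc-injective u≡)
  incident-bundles (suc v) u       w _                (inj₁ refl) = inj₂ refl
  incident-bundles (suc v) u       w (inj₁ w≡)        (inj₂ refl) = inj₁ (sym (suc-injective w≡))

  bundle : Edge G → Fin g
  bundle e = proj₁ (lookup (edges G) e)

  roundRobin : Edge G → Fin k
  roundRobin e = (toℕ e + shift (toℕ (bundle e))) mod k

  position : Fin g → Edge G → ℕ
  position v e = unrolled v (bundle e) (toℕ e)

  located : ∀ e → Located Δ (toℕ e) (lookup (edges G) e)
  located = edges-located Δ odd 3≤g

  position-injective : ∀ v {e e′} → position v e ≡ position v e′ → e ≡ e′
  position-injective v {e} {e′} eq = toℕ-injective
    (unrolled-injective v (bundle e) (bundle e′) (proj₁ (located e)) (proj₁ (located e′)) eq)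

  position-% : ∀ {a} v e → roundRobin e ≡ a → position v e % k ≡ toℕ a
  position-% v e refl = trans (unrolled-% v (bundle e) (toℕ e)) (sym (toℕ-mod _ k))

  position-window : ∀ v e → Incident v (lookup (edges G) e) →
    let W = offset Δ (previous v) + shift (previous v) in
    W ≤ position v e × position v e < W + d * k
  position-window v e inc = in-window (unrolled-within v (bundle e) (proj₁ (located e)))
    (incident-bundles v (bundle e) (proj₂ (lookup (edges G) e)) (proj₂ (located e)) inc)

  -- At `v`, the edges of colour `a` have distinct positions, all congruent to `a` modulo `k` and
  -- all in one window of length `d * k`.
  roundRobin-defective : ∀ a → MaxDegree≤ d (colourClass G roundRobin a)
  roundRobin-defective a v = begin
    degree (colourClass G roundRobin a) v  ≡⟨ degree-colourClass G roundRobin a v ⟩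
    length es                              ≡⟨ length-map (position v) es ⟨
    length (map (position v) es)
      ≤⟨ congruent-in-window⇒length≤
           (Unique.map⁺ (position-injective v)
             (Unique.filter⁺ _ (Unique.filter⁺ (λ e → roundRobin e ≟ a) (Unique.allFin⁺ _))))
           (All.map⁺ (All.map (λ {e} → position-% v e)
             (All.filter⁺ (incident? v ∘ lookup (edges G)) (All.all-filter (λ e → roundRobin e ≟ a) (allFin _)))))
           (All.map⁺ (All.map (λ {e} → position-window v e)
             (All.all-filter (incident? v ∘ lookup (edges G)) (filter (λ e → roundRobin e ≟ a) (allFin _))))) ⟩
    d ∎
    where
    open ≤-Reasoning
    es : List (Edge G)
    es = filter (incident? v ∘ lookup (edges G)) (filter (λ e → roundRobin e ≟ a) (allFin _))

  colouring : DefectiveColouring d G k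
  colouring = record { colour = roundRobin ; defective = roundRobin-defective }

-- Choice of the parameters and matching of the two bounds

odd⇒≡1+2* : ∀ {n} → Odd n → ∃[ h ] n ≡ suc (h * 2)
odd⇒≡1+2* {suc zero}    _   = 0 , refl
odd⇒≡1+2* {suc (suc n)} odd with odd⇒≡1+2* {n} odd
... | h , n≡ = suc h , cong (λ z → suc (suc z)) n≡

odd*odd : ∀ {m n} → Odd m → Odd n → ∃[ h ] m * n ≡ suc (h * 2)
odd*odd {m} {n} odd-m odd-n with odd⇒≡1+2* {m} odd-m | odd⇒≡1+2* {n} odd-n
... | a , refl | b , refl = a * suc (b * 2) + b , expand a b
  where
  expand : ∀ a b → suc (a * 2) * suc (b * 2) ≡ suc ((a * suc (b * 2) + b) * 2)
  expand = solve-∀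

module _ {d Δ m k M : ℕ} (1<d : 1 < d) (d<Δ : d < Δ) (odd : Odd (suc (suc m))) (3≤g : 3 ≤ suc (suc m))
  (d*g≡1+2M : d * suc (suc m) ≡ suc (M * 2))
  (enough : Δ * suc (suc m) ∸ 1 ≤ k * (M * 2)) where
  open ≤-Reasoning

  private
    g N : ℕ
    g = suc (suc m)
    N = offset Δ g

    Δ*g≤ : Δ * g ≤ suc (k * (M * 2))
    Δ*g≤ = ≤-trans (m≤n+m∸n (Δ * g) 1) (s≤s enough)

    1≤k : 1 ≤ k
    -- The lemma on `d * g₀ ∸ 1` is applied with `Δ` in place of `d`: as `Δ * g ∸ 1` is positive,
    -- `k` cannot be `0`.
    1≤k = positive k (≤-trans (>-nonZero⁻¹ _ {{d*g₀∸1-nonZero (<-trans 1<d d<Δ) 3≤g}}) enough)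
      where
      positive : ∀ k → 0 < k * (M * 2) → 1 ≤ k
      positive (suc k) _ = s≤s z≤n

    -- `d * k * g` is `k + k * (M * 2)`, and `1 ≤ k` covers the unit by which `Δ * g` may exceed
    -- `k * (M * 2)`. Thus `s` is a genuine difference.
    Δ≤d*k : Δ ≤ d * k
    Δ≤d*k = *-cancelʳ-≤ Δ (d * k) g (begin
      Δ * g            ≤⟨ Δ*g≤ ⟩
      1 + k * (M * 2)  ≤⟨ +-monoˡ-≤ _ 1≤k ⟩
      k + k * (M * 2)  ≡⟨ *-suc k (M * 2) ⟨
      k * suc (M * 2)  ≡⟨ cong (k *_) d*g≡1+2M ⟨
      k * (d * g)      ≡⟨ rearrange k d g ⟩
      d * k * g        ∎)
      where
      rearrange : ∀ a b c → a * (b * c) ≡ b * a * c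
      rearrange = solve-∀

    N≤M*k : N ≤ M * k
    N≤M*k = 2m≤1+2n⇒m≤n N (M * k) (begin
      N * 2                ≤⟨ 2*offset≤ Δ g odd ⟩
      g * Δ                ≡⟨ *-comm g Δ ⟩
      Δ * g                ≤⟨ Δ*g≤ ⟩
      suc (k * (M * 2))    ≡⟨ cong suc (rearrange k M) ⟩
      suc (M * k * 2)      ∎)
      where
      rearrange : ∀ k M → k * (M * 2) ≡ M * k * 2
      rearrange = solve-∀

    s T : ℕ
    s = d * k ∸ Δ
    T = M * k ∸ N

    Δ+s≡d*k : Δ + s ≡ d * k
    Δ+s≡d*k = m+[n∸m]≡n Δ≤d*k

    N+T≡M*k : N + T ≡ M * k
    N+T≡M*k = m+[n∸m]≡n N≤M*k

    -- Adding `g * Δ` turns the right side into `g * (d * k)`, that is, `k + M * k + M * k`. On the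
    -- left, `g * Δ` is at most `suc (N * 2)` and `N + T` is `M * k`, so what remains is
    -- `1 + N ≤ k + M * k`.
    T≤g*s : T ≤ g * s
    T≤g*s = +-cancelʳ-≤ (g * Δ) T (g * s) (begin
      T + g * Δ            ≤⟨ +-monoʳ-≤ T (≤1+2*offset Δ g odd) ⟩
      T + suc (N * 2)      ≡⟨ rearrange₁ T N ⟩
      1 + (N + T) + N      ≡⟨ cong (λ z → 1 + z + N) N+T≡M*k ⟩
      1 + M * k + N        ≤⟨ +-mono-≤ (+-monoˡ-≤ (M * k) 1≤k) N≤M*k ⟩
      k + M * k + M * k    ≡⟨ rearrange₄ k M ⟨
      k * suc (M * 2)      ≡⟨ cong (k *_) d*g≡1+2M ⟨
      k * (d * g)          ≡⟨ rearrange₂ k d g ⟩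
      g * (d * k)          ≡⟨ cong (g *_) Δ+s≡d*k ⟨
      g * (Δ + s)          ≡⟨ rearrange₃ g Δ s ⟩
      g * s + g * Δ        ∎)
      where
      rearrange₁ : ∀ T N → T + suc (N * 2) ≡ 1 + (N + T) + N
      rearrange₁ = solve-∀
      rearrange₂ : ∀ a b c → a * (b * c) ≡ c * (b * a)
      rearrange₂ = solve-∀
      rearrange₃ : ∀ a b c → a * (b + c) ≡ a * c + a * b
      rearrange₃ = solve-∀
      rearrange₄ : ∀ k M → k * suc (M * 2) ≡ k + M * k + M * k
      rearrange₄ = solve-∀

  enough-colours : DefectiveColouring d (R Δ g 3≤g) k
  enough-colours = RoundRobin.colouring {M = M} {{>-nonZero (<⇒≤ 1<d)}} {{>-nonZero 1≤k}} odd 3≤g Δ+s≡d*k N+T≡M*k T≤g*s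

-- The `∸ 1` absorbs the unit by which `Δ * g` exceeds twice the number of edges when `Δ` is odd.
colours-needed : ∀ {d Δ m M} (odd : Odd (suc (suc m))) (3≤g : 3 ≤ suc (suc m)) →
  d * suc (suc m) ≡ suc (M * 2) → ∀ j → DefectiveColouring d (R Δ (suc (suc m)) 3≤g) j →
  Δ * suc (suc m) ∸ 1 ≤ j * (M * 2)
colours-needed {d} {Δ} {m} {M} odd 3≤g d*g≡1+2M j C = m≤n+o⇒m∸n≤o (Δ * g) 1 (begin
  Δ * g                     ≡⟨ *-comm Δ g ⟩
  g * Δ                     ≤⟨ ≤1+2*offset Δ g odd ⟩
  suc (offset Δ g * 2)      ≡⟨ cong (λ z → suc (z * 2)) (size≡offset Δ odd 3≤g) ⟨
  suc (length (edges (R Δ g 3≤g)) * 2)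
    ≤⟨ s≤s (*-monoˡ-≤ 2 (size≤colours*M {M = M} (trans (*-comm g d) d*g≡1+2M) C)) ⟩
  suc (j * M * 2)           ≡⟨ cong suc (*-assoc j M 2) ⟩
  suc (j * (M * 2))         ∎)
  where
  open ≤-Reasoning
  g : ℕ
  g = suc (suc m)

open import Data.Integer using (+_)

lemma2p8 : ∀ (d g₀ Δ : ℕ) → Odd d → (1<d : 1 < d) → Odd g₀ → (3≤g₀ : 3 ≤ g₀) → d < Δ →
    let instance d*g₀∸1≢0 = d*g₀∸1-nonZero 1<d 3≤g₀ in
    ∃[ k ] (IsDefectiveChromaticIndex d (R Δ g₀ 3≤g₀) k
    × + k ≡ ⌈ + (Δ * g₀ ∸ 1) / (d * g₀ ∸ 1) ⌉)
lemma2p8 d (suc zero) Δ _ _ _ (s≤s ()) _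
lemma2p8 d g₀@(suc (suc m)) Δ odd-d 1<d odd-g 3≤g d<Δ
  with odd*odd {d} {g₀} odd-d odd-g
     | ceiling-least (Δ * g₀ ∸ 1) (d * g₀ ∸ 1) {{d*g₀∸1-nonZero 1<d 3≤g}}
         (>-nonZero⁻¹ _ {{d*g₀∸1-nonZero (<-trans 1<d d<Δ) 3≤g}})
... | M , d*g≡1+2M | k , k≡ , enough , least =
  -- With `d * g₀ ∸ 1` rewritten as `M * 2`, the inequality that defines the ceiling is both what
  -- the colouring requires and what every colouring implies.
  k , ( enough-colours {M = M} 1<d d<Δ odd-g 3≤g d*g≡1+2M (subst (λ z → Δ * g₀ ∸ 1 ≤ k * z) d*g∸1≡2M enough)
      , λ j C → least j (subst (λ z → Δ * g₀ ∸ 1 ≤ j * z) (sym d*g∸1≡2M)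
                          (colours-needed {Δ = Δ} {M = M} odd-g 3≤g d*g≡1+2M j C)))
    , k≡
  where
  d*g∸1≡2M : d * g₀ ∸ 1 ≡ M * 2
  d*g∸1≡2M = cong (_∸ 1) d*g≡1+2M
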